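{- Let $G=(V,E)$ be a finite connected simple undirected graph, let $n=|V|-1$, and fix an orientation $s$ of the edges of $G$. Then there exists a spanning representation $D:E\to\mathbb{R}^n$.
   Context: An orientation is a map $s:V\times V\to\{+1,-1\}$ with $s(u,v)=-s(v,u)$ for every edge $(u,v)\in E$. A direction map is any map $D:E\to\mathbb{R}^n$ (with $D(u,v)=D(v,u)$, since edges are undirected). A path is a walk $p=(v_0,\dots,v_t)$ in $G$ (consecutive vertices adjacent, repetitions allowed); it is a cycle if $v_0=v_t$. The direction of $p$ is $D(p)=\sum_{i=0}^{t-1}s(v_i,v_{i+1})D(v_i,v_{i+1})$. A direction map $D$ is a spanning representation if (1) for every path $p$, $D(p)=0$ if and only if $p$ is a cycle; and (2) for every spanning tree $T$ of $G$, the set of vectors $\{D(t)\}_{t\in T}$ spans $\mathbb{R}^n$. -}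

module Defs where

open import Algebra.Bundles using (CommutativeRing)
open import Data.Fin.Base using (Fin)
open import Data.List.Base using (List; []; _∷_; length)
open import Data.List.Relation.Unary.Unique.Propositional using (Unique)
open import Data.Nat.Base as ℕ using (ℕ)
import Data.Nat.Properties as ℕ
open import Data.Product.Base using (_×_; _,_; ∃-syntax; ∃₂)
open import Data.Rational.Base as ℚ using (ℚ; 0ℚ; 1ℚ; ½; _<_; ∣_∣; 1/_)
import Data.Rational.Properties as ℚ
open import Data.Rational.Solver using (module +-*-Solver)
open +-*-Solver using (solve; con; _:=_; _:+_; _:*_; _:-_; :-_)
open import Data.Sign.Base as Sign using (Sign; opposite)
open import Data.Vec.Functional as Vector using (Vector)
open import Data.Vec.Functional.Relation.Binary.Pointwise using (Pointwise)
open import Function.Bundles using (_⇔_)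
open import Level using (0ℓ)
open import Relation.Binary.Construct.Closure.ReflexiveTransitive using (Star; ε; _◅_)
open import Relation.Binary.Core using (Rel; _⇒_)
open import Relation.Binary.Definitions using (Symmetric; Irreflexive)
open import Relation.Binary.PropositionalEquality.Core
  using (_≡_; refl; sym; trans; cong; subst)
open import Relation.Nullary.Negation.Core using (¬_)

------------------------------------------------------------------------
-- The real numbers, as Cauchy sequences of rationals (with a modulus)
-- under the equivalence "the difference tends to zero".

IsCauchy : (ℕ → ℚ) → Set
IsCauchy f = ∀ {e} → 0ℚ < e →
  ∃[ N ] ∀ {m n} → N ℕ.≤ m → N ℕ.≤ n → ∣ f m ℚ.- f n ∣ < e

record ℝ : Set where
  constructor mkℝ
  field
    seq    : ℕ → ℚ
    cauchy : IsCauchy seq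

open ℝ

infix 4 _≈_

record _≈_ (x y : ℝ) : Set where
  constructor mk≈
  field
    close : ∀ {e} → 0ℚ < e →
      ∃[ N ] ∀ {n} → N ℕ.≤ n → ∣ seq x n ℚ.- seq y n ∣ < e

open _≈_

private
  half-pos : ∀ {e} → 0ℚ < e → 0ℚ < ½ ℚ.* e
  half-pos {e} 0<e =
    subst (_< ½ ℚ.* e) (ℚ.*-zeroʳ ½) (ℚ.*-monoʳ-<-pos ½ 0<e)

  halves : ∀ e → ½ ℚ.* e ℚ.+ ½ ℚ.* e ≡ e
  halves = solve 1 (λ e → con ½ :* e :+ con ½ :* e := e) refl

  ∣a+b∣<e : ∀ {a b e} → ∣ a ∣ < ½ ℚ.* e → ∣ b ∣ < ½ ℚ.* e → ∣ a ℚ.+ b ∣ < e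
  ∣a+b∣<e {a} {b} {e} p q = subst (∣ a ℚ.+ b ∣ <_) (halves e)
    (ℚ.≤-<-trans (ℚ.∣p+q∣≤∣p∣+∣q∣ a b) (ℚ.+-mono-< p q))

  ∣p-q∣≡∣q-p∣ : ∀ p q → ∣ p ℚ.- q ∣ ≡ ∣ q ℚ.- p ∣
  ∣p-q∣≡∣q-p∣ p q = trans
    (cong ∣_∣ (solve 2 (λ p q → p :- q := :- (q :- p)) refl p q))
    (ℚ.∣-p∣≡∣p∣ (q ℚ.- p))

  +-close : ∀ a b c d {e} → ∣ a ℚ.- b ∣ < ½ ℚ.* e → ∣ c ℚ.- d ∣ < ½ ℚ.* e →
            ∣ (a ℚ.+ c) ℚ.- (b ℚ.+ d) ∣ < e
  +-close a b c d {e} p q = subst (λ z → ∣ z ∣ < e)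
    (solve 4 (λ a b c d → (a :- b) :+ (c :- d) := (a :+ c) :- (b :+ d)) refl a b c d)
    (∣a+b∣<e p q)

  neg-close : ∀ a b {e} → ∣ a ℚ.- b ∣ < e → ∣ (ℚ.- a) ℚ.- (ℚ.- b) ∣ < e
  neg-close a b {e} p = subst (λ z → ∣ z ∣ < e)
    (solve 2 (λ a b → b :- a := (:- a) :- (:- b)) refl a b)
    (subst (_< e) (∣p-q∣≡∣q-p∣ a b) p)

  trans-close : ∀ a b c {e} → ∣ a ℚ.- b ∣ < ½ ℚ.* e → ∣ b ℚ.- c ∣ < ½ ℚ.* e →
                ∣ a ℚ.- c ∣ < e
  trans-close a b c {e} p q = subst (λ z → ∣ z ∣ < e)
    (solve 3 (λ a b c → (a :- b) :+ (b :- c) := a :- c) refl a b c)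
    (∣a+b∣<e p q)

  ∣p-p∣<e : ∀ p {e} → 0ℚ < e → ∣ p ℚ.- p ∣ < e
  ∣p-p∣<e p {e} = subst (λ z → ∣ z ∣ < e) (sym (ℚ.+-inverseʳ p))

  quotient : ∀ {B e} → 0ℚ < B → 0ℚ < e → ∃[ d ] 0ℚ < d × B ℚ.* d ≡ e
  quotient {B} {e} 0<B 0<e = 1/B ℚ.* e , 0<d , eq
    where
    instance
      B-pos : ℚ.Positive B
      B-pos = ℚ.positive 0<B
      B-nonZero : ℚ.NonZero B
      B-nonZero = ℚ.pos⇒nonZero B
    1/B = 1/ B
    instance
      1/B-pos : ℚ.Positive 1/B
      1/B-pos = ℚ.1/pos⇒pos B
    0<d : 0ℚ < 1/B ℚ.* e
    0<d = subst (_< 1/B ℚ.* e) (ℚ.*-zeroʳ 1/B) (ℚ.*-monoʳ-<-pos 1/B 0<e)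
    eq : B ℚ.* (1/B ℚ.* e) ≡ e
    eq = trans (sym (ℚ.*-assoc B 1/B e))
           (trans (cong (ℚ._* e) (ℚ.*-inverseʳ B)) (ℚ.*-identityˡ e))

  ∣ab∣<Ad : ∀ a b {A d} → 0ℚ < A → ∣ a ∣ < A → ∣ b ∣ < d → ∣ a ℚ.* b ∣ < A ℚ.* d
  ∣ab∣<Ad a b {A} {d} 0<A p q = subst (_< A ℚ.* d) (sym (ℚ.∣p*q∣≡∣p∣*∣q∣ a b))
    (ℚ.≤-<-trans
      (ℚ.*-monoʳ-≤-nonNeg ∣ b ∣ {{ℚ.∣-∣-nonNeg b}} (ℚ.<⇒≤ p))
      (ℚ.*-monoʳ-<-pos A {{ℚ.positive 0<A}} q))

  *-close : ∀ a b c d {A D e} → 0ℚ < A → 0ℚ < D → ∣ a ∣ < A → ∣ d ∣ < D →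
            ∀ {g h} → A ℚ.* g ≡ ½ ℚ.* e → D ℚ.* h ≡ ½ ℚ.* e →
            ∣ c ℚ.- d ∣ < g → ∣ a ℚ.- b ∣ < h → ∣ (a ℚ.* c) ℚ.- (b ℚ.* d) ∣ < e
  *-close a b c d {e = e} 0<A 0<D a<A d<D Ag Dh p q = subst (λ z → ∣ z ∣ < e)
    (solve 4 (λ a b c d →
      (a :* (c :- d)) :+ (d :* (a :- b)) := (a :* c) :- (b :* d)) refl a b c d)
    (∣a+b∣<e (subst (∣ a ℚ.* (c ℚ.- d) ∣ <_) Ag (∣ab∣<Ad a (c ℚ.- d) 0<A a<A p))
             (subst (∣ d ℚ.* (a ℚ.- b) ∣ <_) Dh (∣ab∣<Ad d (a ℚ.- b) 0<D d<D q)))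

  0<1 : 0ℚ < 1ℚ
  0<1 = ℚ.positive⁻¹ 1ℚ

  bounded : ∀ x → ∃[ B ] 0ℚ < B × ∃[ N ] ∀ {n} → N ℕ.≤ n → ∣ seq x n ∣ < B
  bounded x =
    let N , p = cauchy x 0<1 in
    1ℚ ℚ.+ ∣ seq x N ∣ ,
    ℚ.+-mono-<-≤ 0<1 (ℚ.0≤∣p∣ (seq x N)) ,
    N , λ {n} i → subst (λ z → ∣ z ∣ < 1ℚ ℚ.+ ∣ seq x N ∣)
      (solve 2 (λ a b → (a :- b) :+ b := a) refl (seq x n) (seq x N))
      (ℚ.≤-<-trans (ℚ.∣p+q∣≤∣p∣+∣q∣ (seq x n ℚ.- seq x N) (seq x N))
                   (ℚ.+-monoˡ-< ∣ seq x N ∣ (p i ℕ.≤-refl)))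

  ⊔ˡ : ∀ {a b c} → a ℕ.⊔ b ℕ.≤ c → a ℕ.≤ c
  ⊔ˡ = ℕ.m⊔n≤o⇒m≤o _ _

  ⊔ʳ : ∀ {a b c} → a ℕ.⊔ b ℕ.≤ c → b ℕ.≤ c
  ⊔ʳ = ℕ.m⊔n≤o⇒n≤o _ _

infixl 6 _+_
infixl 7 _*_
infix  8 -_

fromℚ : ℚ → ℝ
fromℚ q = mkℝ (λ _ → q) (λ 0<e → 0 , λ _ _ → ∣p-p∣<e q 0<e)

_+_ : ℝ → ℝ → ℝ
seq    (x + y) n   = seq x n ℚ.+ seq y n
cauchy (x + y) 0<e =
  let M , p = cauchy x (half-pos 0<e)
      N , q = cauchy y (half-pos 0<e)
  in M ℕ.⊔ N , λ {m} {n} i j →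
    +-close (seq x m) (seq x n) (seq y m) (seq y n)
      (p (⊔ˡ i) (⊔ˡ j)) (q (⊔ʳ {M} i) (⊔ʳ {M} j))

-_ : ℝ → ℝ
seq    (- x) n   = ℚ.- seq x n
cauchy (- x) 0<e =
  let N , p = cauchy x 0<e
  in N , λ {m} {n} i j → neg-close (seq x m) (seq x n) (p i j)

_*_ : ℝ → ℝ → ℝ
seq    (x * y) n   = seq x n ℚ.* seq y n
cauchy (x * y) 0<e =
  let A , 0<A , K , a = bounded x
      B , 0<B , L , b = bounded y
      g , 0<g , Ag    = quotient 0<A (half-pos 0<e)
      h , 0<h , Bh    = quotient 0<B (half-pos 0<e)
      M , p           = cauchy x 0<h
      N , q           = cauchy y 0<g
  in (K ℕ.⊔ L) ℕ.⊔ (M ℕ.⊔ N) , λ {m} {n} i j →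
    *-close (seq x m) (seq x n) (seq y m) (seq y n) 0<A 0<B
      (a (⊔ˡ {K} {L} (⊔ˡ i))) (b (⊔ʳ {K} {L} (⊔ˡ j))) Ag Bh
      (q (⊔ʳ {M} (⊔ʳ {K ℕ.⊔ L} i)) (⊔ʳ {M} (⊔ʳ {K ℕ.⊔ L} j)))
      (p (⊔ˡ {M} (⊔ʳ {K ℕ.⊔ L} i)) (⊔ˡ {M} (⊔ʳ {K ℕ.⊔ L} j)))

private
  pointwise : ∀ {x y} → (∀ n → seq x n ≡ seq y n) → x ≈ y
  pointwise {x} {y} eq .close {e} 0<e = 0 , λ {n} _ →
    subst (λ z → ∣ seq x n ℚ.- z ∣ < e) (eq n) (∣p-p∣<e (seq x n) 0<e)

  ≈-sym : ∀ {x y} → x ≈ y → y ≈ x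
  ≈-sym {x} {y} x≈y .close {e} 0<e =
    let N , p = close x≈y 0<e
    in N , λ {n} i → subst (_< e) (∣p-q∣≡∣q-p∣ (seq x n) (seq y n)) (p i)

  ≈-trans : ∀ {x y z} → x ≈ y → y ≈ z → x ≈ z
  ≈-trans {x} {y} {z} x≈y y≈z .close 0<e =
    let M , p = close x≈y (half-pos 0<e)
        N , q = close y≈z (half-pos 0<e)
    in M ℕ.⊔ N , λ {n} i →
      trans-close (seq x n) (seq y n) (seq z n) (p (⊔ˡ i)) (q (⊔ʳ {M} i))

  +-cong : ∀ {x x′ y y′} → x ≈ x′ → y ≈ y′ → x + y ≈ x′ + y′
  +-cong {x} {x′} {y} {y′} x≈x′ y≈y′ .close 0<e =
    let M , p = close x≈x′ (half-pos 0<e)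
        N , q = close y≈y′ (half-pos 0<e)
    in M ℕ.⊔ N , λ {n} i →
      +-close (seq x n) (seq x′ n) (seq y n) (seq y′ n) (p (⊔ˡ i)) (q (⊔ʳ {M} i))

  -‿cong : ∀ {x y} → x ≈ y → - x ≈ - y
  -‿cong {x} {y} x≈y .close 0<e =
    let N , p = close x≈y 0<e
    in N , λ {n} i → neg-close (seq x n) (seq y n) (p i)

  *-cong : ∀ {x x′ y y′} → x ≈ x′ → y ≈ y′ → x * y ≈ x′ * y′
  *-cong {x} {x′} {y} {y′} x≈x′ y≈y′ .close 0<e =
    let A , 0<A , K , a = bounded x
        B , 0<B , L , b = bounded y′
        g , 0<g , Ag    = quotient 0<A (half-pos 0<e)
        h , 0<h , Bh    = quotient 0<B (half-pos 0<e)
        M , p           = close x≈x′ 0<h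
        N , q           = close y≈y′ 0<g
    in (K ℕ.⊔ L) ℕ.⊔ (M ℕ.⊔ N) , λ {n} i →
      *-close (seq x n) (seq x′ n) (seq y n) (seq y′ n) 0<A 0<B
        (a (⊔ˡ {K} {L} (⊔ˡ i))) (b (⊔ʳ {K} {L} (⊔ˡ i))) Ag Bh
        (q (⊔ʳ {M} (⊔ʳ {K ℕ.⊔ L} i))) (p (⊔ˡ {M} (⊔ʳ {K ℕ.⊔ L} i)))

ℝ-commutativeRing : CommutativeRing 0ℓ 0ℓ
ℝ-commutativeRing = record
  { Carrier = ℝ
  ; _≈_ = _≈_
  ; _+_ = _+_
  ; _*_ = _*_
  ; -_ = -_
  ; 0# = fromℚ 0ℚ
  ; 1# = fromℚ 1ℚ
  ; isCommutativeRing = record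
    { isRing = record
      { +-isAbelianGroup = record
        { isGroup = record
          { isMonoid = record
            { isSemigroup = record
              { isMagma = record
                { isEquivalence = record
                  { refl = pointwise λ _ → refl ; sym = ≈-sym ; trans = ≈-trans }
                ; ∙-cong = +-cong
                }
              ; assoc = λ x y z → pointwise λ n → ℚ.+-assoc (seq x n) (seq y n) (seq z n)
              }
            ; identity = (λ x → pointwise λ n → ℚ.+-identityˡ (seq x n))
                       , (λ x → pointwise λ n → ℚ.+-identityʳ (seq x n))
            }
          ; inverse = (λ x → pointwise λ n → ℚ.+-inverseˡ (seq x n))
                    , (λ x → pointwise λ n → ℚ.+-inverseʳ (seq x n))
          ; ⁻¹-cong = -‿cong
          }
        ; comm = λ x y → pointwise λ n → ℚ.+-comm (seq x n) (seq y n)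
        }
      ; *-cong = *-cong
      ; *-assoc = λ x y z → pointwise λ n → ℚ.*-assoc (seq x n) (seq y n) (seq z n)
      ; *-identity = (λ x → pointwise λ n → ℚ.*-identityˡ (seq x n))
                   , (λ x → pointwise λ n → ℚ.*-identityʳ (seq x n))
      ; distrib = (λ x y z → pointwise λ n → ℚ.*-distribˡ-+ (seq x n) (seq y n) (seq z n))
                , (λ x y z → pointwise λ n → ℚ.*-distribʳ-+ (seq x n) (seq y n) (seq z n))
      }
    ; *-comm = λ x y → pointwise λ n → ℚ.*-comm (seq x n) (seq y n)
    }
  }

------------------------------------------------------------------------
-- The vector space ℝⁿ

ℝ^_ : ℕ → Set
ℝ^ n = Vector ℝ n

infix  4 _≈ᵥ_
infixl 6 _+ᵥ_
infixr 7 _·_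

_≈ᵥ_ : ∀ {n} → Rel (ℝ^ n) 0ℓ
_≈ᵥ_ = Pointwise _≈_

0ᵥ : ∀ {n} → ℝ^ n
0ᵥ = Vector.replicate _ (fromℚ 0ℚ)

_+ᵥ_ : ∀ {n} → ℝ^ n → ℝ^ n → ℝ^ n
_+ᵥ_ = Vector.zipWith _+_

_·_ : ∀ {n} → ℝ → ℝ^ n → ℝ^ n
c · x = Vector.map (c *_) x

linearCombination : ∀ {n} {I : Set} → (I → ℝ^ n) → List (ℝ × I) → ℝ^ n
linearCombination x []             = 0ᵥ
linearCombination x ((c , i) ∷ cs) = c · x i +ᵥ linearCombination x cs

Spans : ∀ {n} {I : Set} → (I → ℝ^ n) → Set
Spans x = ∀ w → ∃[ cs ] linearCombination x cs ≈ᵥ w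

------------------------------------------------------------------------
-- Graphs

record SimpleGraph (V : Set) : Set₁ where
  field
    Adj     : Rel V 0ℓ
    adj-sym : Symmetric Adj
    irrefl  : Irreflexive _≡_ Adj

open SimpleGraph using (Adj)

module _ {V : Set} where

  -- Edges are listed with an order of their endpoints, so each
  -- undirected edge occurs once for each order.
  Edge : SimpleGraph V → Set
  Edge G = ∃₂ (Adj G)

  -- Walks from u to v; vertices and edges may be repeated.
  Path : SimpleGraph V → Rel V 0ℓ
  Path G = Star (Adj G)

  IsCycle : ∀ {R : Rel V 0ℓ} {u v} → Star R u v → Set
  IsCycle {u = u} {v} _ = u ≡ v

  vertices : ∀ {R : Rel V 0ℓ} {u v} → Star R u v → List V
  vertices {u = u} ε       = u ∷ []
  vertices {u = u} (_ ◅ p) = u ∷ vertices p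

  Connected : SimpleGraph V → Set
  Connected G = ∀ u v → Path G u v

  -- Unlike IsCycle, acyclicity refers to graph-theoretic cycles: a path
  -- through at least three distinct vertices, closed up by one more edge.
  Acyclic : SimpleGraph V → Set
  Acyclic G = ∀ {u v} (p : Path G u v) →
    Unique (vertices p) → 3 ℕ.≤ length (vertices p) → ¬ Adj G v u

  record IsSpanningTree (G T : SimpleGraph V) : Set where
    field
      subgraph  : Adj T ⇒ Adj G
      connected : Connected T
      acyclic   : Acyclic T

  record Orientation (G : SimpleGraph V) : Set where
    field
      sign    : V → V → Sign
      antisym : ∀ {u v} → Adj G u v → sign u v ≡ opposite (sign v u)

  -- The symmetry law also makes the value independent of the proof of
  -- adjacency, so that dir is a function on undirected edges.
  record DirectionMap (G : SimpleGraph V) (n : ℕ) : Set where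
    field
      dir     : ∀ {u v} → Adj G u v → ℝ^ n
      dir-sym : ∀ {u v} (e : Adj G u v) (e′ : Adj G v u) → dir e ≈ᵥ dir e′

  fromSign : Sign → ℝ
  fromSign Sign.+ = fromℚ 1ℚ
  fromSign Sign.- = - fromℚ 1ℚ

  module _ {G : SimpleGraph V} {n : ℕ} (s : Orientation G) (D : DirectionMap G n) where
    open Orientation s
    open DirectionMap D

    direction : ∀ {u v} → Path G u v → ℝ^ n
    direction ε                 = 0ᵥ
    direction (_◅_ {u} {v} e p) = fromSign (sign u v) · dir e +ᵥ direction p

    record IsSpanningRepresentation : Set₁ where
      field
        zero⇔cycle : ∀ {u v} (p : Path G u v) → direction p ≈ᵥ 0ᵥ ⇔ IsCycle p
        tree-spans : ∀ {T} (tree : IsSpanningTree G T) →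
          Spans λ ((_ , _ , t) : Edge T) → dir (IsSpanningTree.subgraph tree t)

{-# OPTIONS --safe #-}

-- Give the vertices v₀, …, vₙ the potentials 0, e₁, …, eₙ and let D(u,v) be
-- s(u,v) times the potential difference from u to v.  The direction of a path
-- telescopes to the potential difference of its ends, and distinct vertices
-- have distinct potentials.  In a connected subgraph, the path from v₀ to vᵢ
-- writes eᵢ as a combination of edge directions.
module Submission where

open import Algebra.Bundles using (CommutativeRing)
import Algebra.Properties.Group as GroupProperties
import Algebra.Properties.Ring as RingProperties
import Algebra.Properties.Semiring.Sum as SemiringSum
open import Data.Empty using (⊥-elim)
open import Data.Fin.Base using (Fin; zero; suc)
open import Data.List.Base using (List; []; _∷_; _++_; map)
open import Data.Nat.Base using (ℕ; zero; suc)
import Data.Nat.Properties as ℕ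
open import Data.Product.Base using (∃-syntax; _×_; _,_; map₁)
open import Data.Rational.Base using (0ℚ; 1ℚ)
import Data.Rational.Properties as ℚ
open import Data.Sign.Base as Sign using (Sign; opposite)
open import Data.Vec.Functional using (Vector; tail)
open import Function.Base using (_∘_)
open import Function.Bundles using (_↔_; Inverse; mk⇔)
open import Function.Consequences.Propositional using (inverseʳ⇒injective)
open import Level using (0ℓ)
open import Relation.Binary.Construct.Closure.ReflexiveTransitive using (Star; ε; _◅_)
open import Relation.Binary.Core using (Rel)
open import Relation.Binary.PropositionalEquality.Core using (_≡_; refl; cong)
open import Relation.Nullary.Negation.Core using (¬_)

-- The operations of ℝ are defined by copatterns, so comparing two compound real
-- expressions unfolds their Cauchy proofs.  Hence all calculations take place in
-- an arbitrary ring, and the notions of Defs enter as parameters characterised by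
-- equations so small that each holds by refl without such unfolding.
module LinearAlgebra {c ℓ} (R : CommutativeRing c ℓ) where
  open CommutativeRing R hiding (zero)
    renaming (refl to ≈-refl; sym to ≈-sym; trans to ≈-trans)
  open GroupProperties +-group using (⁻¹-involutive; ε⁻¹≈ε; x∙y⁻¹≈ε⇒x≈y)
  open RingProperties ring using (-‿distribˡ-*; -‿distribʳ-*; -‿+-comm)
  open SemiringSum semiring using (sum; sum-cong-≋; sum-replicate-zero)
  open import Relation.Binary.Reasoning.Setoid setoid

  -- Signs as ring elements, and signed differences of potentials.

  unit : Sign → Carrier
  unit Sign.+ = 1#
  unit Sign.- = - 1#

  -- The detour through `one` lets both sides of the equation at `Sign.-` negate literally the same
  -- term.
  unit-unique : (f : Sign → Carrier) (one : Carrier) →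
                one ≡ 1# → f Sign.+ ≡ one → f Sign.- ≡ - one → ∀ σ → f σ ≡ unit σ
  unit-unique f one refl f-+ f-- Sign.+ = f-+
  unit-unique f one refl f-+ f-- Sign.- = f--

  unit-square : ∀ σ → unit σ * unit σ ≈ 1#
  unit-square Sign.+ = *-identityˡ 1#
  unit-square Sign.- = begin
    - 1# * - 1#    ≈⟨ -‿distribˡ-* 1# (- 1#) ⟨
    - (1# * - 1#)  ≈⟨ -‿cong (*-identityˡ (- 1#)) ⟩
    - - 1#         ≈⟨ ⁻¹-involutive 1# ⟩
    1#             ∎

  unit-opposite : ∀ σ → unit (opposite σ) ≈ - unit σ
  unit-opposite Sign.+ = ≈-refl
  unit-opposite Sign.- = ≈-sym (⁻¹-involutive 1#)

  -- An edge direction contains its sign once and a path's direction multiplies by it again; the two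
  -- factors square to one.
  unit-cancel : ∀ σ x → unit σ * (unit σ * x) ≈ x
  unit-cancel σ x = begin
    unit σ * (unit σ * x)  ≈⟨ *-assoc (unit σ) (unit σ) x ⟨
    unit σ * unit σ * x    ≈⟨ *-congʳ (unit-square σ) ⟩
    1# * x                 ≈⟨ *-identityˡ x ⟩
    x                      ∎

  telescope : ∀ x y z → (y - x) + (z - y) ≈ z - x
  telescope x y z = begin
    (y - x) + (z - y)    ≈⟨ +-comm _ _ ⟩
    (z - y) + (y - x)    ≈⟨ +-assoc z (- y) _ ⟩
    z + (- y + (y - x))  ≈⟨ +-congˡ (+-assoc (- y) y (- x)) ⟨
    z + ((- y + y) - x)  ≈⟨ +-congˡ (+-congʳ (-‿inverseˡ y)) ⟩
    z + (0# - x)         ≈⟨ +-congˡ (+-identityˡ (- x)) ⟩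
    z - x                ∎

  -- The discrete gradient of `φ`, twisted by the orientation so that it becomes a function of the
  -- undirected edge.
  signedDifference : ∀ {n} {V : Set} → (V → V → Sign) → (V → Vector Carrier n) →
                     V → V → Vector Carrier n
  signedDifference sign φ u v k = unit (sign u v) * (φ v k - φ u k)

  -- Swapping the endpoints negates both the sign and the difference, so their product is unchanged.
  signedDifference-sym :
    ∀ {n} {V : Set} (sign : V → V → Sign) (φ : V → Vector Carrier n) {u v} →
    sign u v ≡ opposite (sign v u) → ∀ k →
    signedDifference sign φ u v k ≈ signedDifference sign φ v u k
  signedDifference-sym sign φ {u} {v} eq k rewrite eq = begin
    unit (opposite σ) * (y - x)  ≈⟨ *-congʳ (unit-opposite σ) ⟩
    - unit σ * (y - x)           ≈⟨ -‿distribˡ-* (unit σ) (y - x) ⟨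
    - (unit σ * (y - x))         ≈⟨ -‿distribʳ-* (unit σ) (y - x) ⟩
    unit σ * - (y - x)           ≈⟨ *-congˡ (-‿+-comm y (- x)) ⟨
    unit σ * (- y - - x)         ≈⟨ *-congˡ (+-congˡ (⁻¹-involutive x)) ⟩
    unit σ * (- y + x)           ≈⟨ *-congˡ (+-comm (- y) x) ⟩
    unit σ * (x - y)             ∎
    where
    σ = sign v u
    x = φ u k
    y = φ v k

  -- Path directions as differences of potentials.

  module Telescoping
    {n} {V : Set} {_~_ : Rel V 0ℓ} (sign : V → V → Sign) (φ : V → Vector Carrier n)
    (fromSign    : Sign → Carrier)
    (fromSign-≡  : ∀ σ → fromSign σ ≡ unit σ)
    (dir         : ∀ {u v} → u ~ v → Vector Carrier n)
    (dir-≡       : ∀ {u v} (e : u ~ v) k → dir e k ≡ signedDifference sign φ u v k)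
    (step        : ∀ {u v} → u ~ v → Vector Carrier n)
    (step-≡      : ∀ {u v} (e : u ~ v) k → step e k ≡ fromSign (sign u v) * dir e k)
    (direction   : ∀ {u v} → Star _~_ u v → Vector Carrier n)
    (direction-ε : ∀ {u} k → direction {u} ε k ≡ 0#)
    (direction-◅ : ∀ {u v w} (e : u ~ v) (p : Star _~_ v w) k →
                   direction (e ◅ p) k ≡ step e k + direction p k)
    where

    direction-telescopes : ∀ {u v} (p : Star _~_ u v) k →
                           direction p k ≈ φ v k - φ u k
    direction-telescopes {u} ε k rewrite direction-ε {u} k =
      ≈-sym (-‿inverseʳ (φ u k))
    direction-telescopes {u} {w} (_◅_ {_} {v} e p) k
      rewrite direction-◅ e p k | step-≡ e k | dir-≡ e k | fromSign-≡ (sign u v) =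
      ≈-trans (+-cong (unit-cancel (sign u v) (φ v k - φ u k)) (direction-telescopes p k))
              (telescope (φ u k) (φ v k) (φ w k))

    zero⇒equal-potentials : ∀ {u v} (p : Star _~_ u v) →
                            (∀ k → direction p k ≈ 0#) → ∀ k → φ u k ≈ φ v k
    zero⇒equal-potentials {u} {v} p p≈0 k = ≈-sym (x∙y⁻¹≈ε⇒x≈y (φ v k) (φ u k)
      (≈-trans (≈-sym (direction-telescopes p k)) (p≈0 k)))

    cycle⇒zero : ∀ {u} (p : Star _~_ u u) k → direction p k ≈ 0#
    cycle⇒zero {u} p k = ≈-trans (direction-telescopes p k) (-‿inverseʳ (φ u k))

  -- The standard basis and the injectivity of the potentials.

  δ : ∀ {n} → Fin n → Fin n → Carrier
  δ zero    zero    = 1#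
  δ zero    (suc _) = 0#
  δ (suc _) zero    = 0#
  δ (suc i) (suc j) = δ i j

  δ-diagonal : ∀ {n} (i : Fin n) → δ i i ≈ 1#
  δ-diagonal zero    = ≈-refl
  δ-diagonal (suc i) = δ-diagonal i

  -- In coordinate `j` only the diagonal term survives. This is the expansion of `w` in the standard
  -- basis.
  sum-δ : ∀ {n} (w : Vector Carrier n) j → sum (λ i → w i * δ i j) ≈ w j
  sum-δ {suc n} w zero = begin
    w zero * 1# + sum (λ i → w (suc i) * 0#)
      ≈⟨ +-cong (*-identityʳ (w zero)) (sum-cong-≋ (zeroʳ ∘ tail w)) ⟩
    w zero + sum {n} (λ _ → 0#)
      ≈⟨ +-congˡ (sum-replicate-zero n) ⟩
    w zero + 0#
      ≈⟨ +-identityʳ (w zero) ⟩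
    w zero ∎
  sum-δ w (suc j) = begin
    w zero * 0# + sum (λ i → w (suc i) * δ i j)
      ≈⟨ +-cong (zeroʳ (w zero)) (sum-δ (tail w) j) ⟩
    0# + w (suc j)
      ≈⟨ +-identityˡ (w (suc j)) ⟩
    w (suc j) ∎

  -- The standard basis preceded by the zero vector.
  potential : ∀ {n} → Fin (suc n) → Vector Carrier n
  potential a j = δ a (suc j)

  module _ (0≉1 : ¬ 0# ≈ 1#) where

    δ≈1⇒≡ : ∀ {n} (i j : Fin n) → δ i j ≈ 1# → i ≡ j
    δ≈1⇒≡ zero    zero    _   = refl
    δ≈1⇒≡ zero    (suc j) 0≈1 = ⊥-elim (0≉1 0≈1)
    δ≈1⇒≡ (suc i) zero    0≈1 = ⊥-elim (0≉1 0≈1)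
    δ≈1⇒≡ (suc i) (suc j) δ≈1 = cong suc (δ≈1⇒≡ i j δ≈1)

    -- If `b` is `suc j`, its potential is 1 in coordinate `j`, and among all potentials only that
    -- of `suc j` has a 1 there. If only `b` is zero, the coordinate belonging to `a` would give 0 =
    -- 1.
    potential-injective : ∀ {n} (a b : Fin (suc n)) →
                          (∀ k → potential a k ≈ potential b k) → a ≡ b
    potential-injective zero    zero    _  = refl
    potential-injective a       (suc j) eq =
      δ≈1⇒≡ a (suc j) (≈-trans (eq j) (δ-diagonal j))
    potential-injective (suc i) zero    eq =
      ⊥-elim (0≉1 (≈-trans (≈-sym (eq i)) (δ-diagonal i)))

  -- Closure properties of spans, and spanning by edge directions.

  module Span
    {n} {I : Set} (x : I → Vector Carrier n)
    (scaled   : Carrier → I → Vector Carrier n)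
    (scaled-≡ : ∀ c i k → scaled c i k ≡ c * x i k)
    (lc       : List (Carrier × I) → Vector Carrier n)
    (lc-[]    : ∀ k → lc [] k ≡ 0#)
    (lc-∷     : ∀ c i cs k → lc ((c , i) ∷ cs) k ≡ scaled c i k + lc cs k)
    where

    InSpan : Vector Carrier n → Set _
    InSpan w = ∃[ cs ] ∀ k → lc cs k ≈ w k

    lc-++ : ∀ cs ds k → lc (cs ++ ds) k ≈ lc cs k + lc ds k
    lc-++ []             ds k rewrite lc-[] k = ≈-sym (+-identityˡ _)
    lc-++ ((c , i) ∷ cs) ds k rewrite lc-∷ c i (cs ++ ds) k | lc-∷ c i cs k =
      ≈-trans (+-congˡ (lc-++ cs ds k)) (≈-sym (+-assoc _ _ _))

    lc-scale : ∀ c cs k → lc (map (map₁ (c *_)) cs) k ≈ c * lc cs k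
    lc-scale c []             k rewrite lc-[] k = ≈-sym (zeroʳ c)
    lc-scale c ((d , i) ∷ cs) k
      rewrite lc-∷ (c * d) i (map (map₁ (c *_)) cs) k | lc-∷ d i cs k
            | scaled-≡ (c * d) i k | scaled-≡ d i k =
      ≈-trans (+-cong (*-assoc c d (x i k)) (lc-scale c cs k))
              (≈-sym (distribˡ c _ _))

    span-resp-≈ : ∀ {v w} → (∀ k → v k ≈ w k) → InSpan v → InSpan w
    span-resp-≈ v≈w (cs , eq) = cs , λ k → ≈-trans (eq k) (v≈w k)

    span-0 : InSpan (λ _ → 0#)
    span-0 = [] , λ k → reflexive (lc-[] k)

    span-+ : ∀ {v w} → InSpan v → InSpan w → InSpan (λ k → v k + w k)
    span-+ (cs , p) (ds , q) = cs ++ ds , λ k →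
      ≈-trans (lc-++ cs ds k) (+-cong (p k) (q k))

    span-* : ∀ c {w} → InSpan w → InSpan (λ k → c * w k)
    span-* c (cs , p) = map (map₁ (c *_)) cs , λ k →
      ≈-trans (lc-scale c cs k) (*-congˡ (p k))

    span-generator : ∀ i → InSpan (x i)
    span-generator i = (1# , i) ∷ [] , eq
      where
      eq : ∀ k → lc ((1# , i) ∷ []) k ≈ x i k
      eq k rewrite lc-∷ 1# i [] k | lc-[] k | scaled-≡ 1# i k =
        ≈-trans (+-identityʳ _) (*-identityˡ (x i k))

    span-sum : ∀ {m} (f : Fin m → Vector Carrier n) → (∀ i → InSpan (f i)) →
               InSpan (λ k → sum (λ i → f i k))
    span-sum {zero}  f _ = span-0
    span-sum {suc m} f p = span-+ (p zero) (span-sum (tail f) (p ∘ suc))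

    basis⇒spans : (∀ i → InSpan (δ i)) → ∀ w → InSpan w
    basis⇒spans p w = span-resp-≈ (sum-δ w)
      (span-sum (λ i k → w i * δ i k) (λ i → span-* (w i) (p i)))

    module _
      {V : Set} (sign : V → V → Sign) (φ : V → Vector Carrier n)
      {_~_ : Rel V 0ℓ} (edge : ∀ {u v} → u ~ v → I)
      (edge-≡ : ∀ {u v} (e : u ~ v) k → x (edge e) k ≡ signedDifference sign φ u v k)
      where

      -- By induction on the path: scaling each generator by its own sign recovers the plain
      -- difference along that edge, and these differences telescope.
      span-path : ∀ {u v} → Star _~_ u v → InSpan (λ k → φ v k - φ u k)
      span-path {u}     ε = span-resp-≈ (λ k → ≈-sym (-‿inverseʳ (φ u k))) span-0
      span-path {u} {w} (_◅_ {_} {v} e p) =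
        span-resp-≈ (λ k → telescope (φ u k) (φ v k) (φ w k))
          (span-+ (span-resp-≈ unsign (span-* (unit (sign u v)) (span-generator (edge e))))
                  (span-path p))
        where
        unsign : ∀ k → unit (sign u v) * x (edge e) k ≈ φ v k - φ u k
        unsign k rewrite edge-≡ e k = unit-cancel (sign u v) (φ v k - φ u k)

      -- Since the root has potential zero, the difference along a path from it to `b i` is the
      -- basis vector `δ i` itself.
      potentials-span : (root : V) → (∀ k → φ root k ≡ 0#) →
                        (b : Fin n → V) → (∀ i k → φ (b i) k ≡ δ i k) →
                        (∀ v → Star _~_ root v) → ∀ w → InSpan w
      potentials-span root φ-root b φ-b path = basis⇒spans λ i →
        span-resp-≈ (difference i) (span-path (path (b i)))
        where
        difference : ∀ i k → φ (b i) k - φ root k ≈ δ i k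
        difference i k rewrite φ-root k | φ-b i k =
          ≈-trans (+-congˡ ε⁻¹≈ε) (+-identityʳ (δ i k))

-- Instantiation at the real numbers and the spanning representation.

open import Defs
open LinearAlgebra ℝ-commutativeRing

0≉1 : ¬ fromℚ 0ℚ ≈ fromℚ 1ℚ
-- With tolerance 1, closeness of the constant sequences 0 and 1 gives `1 < 1`.
0≉1 0≈1 with _≈_.close 0≈1 (ℚ.positive⁻¹ 1ℚ)
... | _ , close = ℚ.<-irrefl refl (close ℕ.≤-refl)

fromSign-≡-unit : ∀ {V} σ → fromSign {V} σ ≡ unit σ
fromSign-≡-unit {V} = unit-unique (fromSign {V}) (fromℚ 1ℚ) refl refl refl

module _ {V : Set} {n : ℕ} {G : SimpleGraph V} (s : Orientation G) (φ : V → ℝ^ n) where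
  open SimpleGraph G using (Adj)
  open Orientation s

  differences : DirectionMap G n
  differences = record
    { dir     = λ {u} {v} _ → signedDifference sign φ u v
    ; dir-sym = λ e _ → signedDifference-sym sign φ (antisym e)
    }

  open DirectionMap differences using (dir)

  open Telescoping {_~_ = Adj} sign φ (fromSign {V}) (fromSign-≡-unit {V})
    dir (λ _ _ → refl)
    (λ {u} {v} e → fromSign {V} (sign u v) · dir e) (λ _ _ → refl)
    (direction s differences) (λ _ → refl) (λ _ _ _ → refl)
    public using (zero⇒equal-potentials; cycle⇒zero)

  connected-subgraph-spans :
    ∀ {T} (T⊆G : ∀ {u v} → SimpleGraph.Adj T u v → Adj u v) → Connected T →
    (root : V) → (∀ k → φ root k ≡ fromℚ 0ℚ) →
    (b : Fin n → V) → (∀ i k → φ (b i) k ≡ δ i k) →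
    Spans λ ((_ , _ , t) : Edge T) → dir (T⊆G t)
  connected-subgraph-spans {T} T⊆G conn root φ-root b φ-b =
    potentials-span sign φ (λ {u} {v} t → u , v , t) (λ _ _ → refl)
      root φ-root b φ-b (conn root)
    where
    x : Edge T → ℝ^ n
    x (_ , _ , t) = dir (T⊆G t)

    open Span x (λ c i → c · x i) (λ _ _ _ → refl)
      (linearCombination x) (λ _ → refl) (λ _ _ _ _ → refl)

theorem3p3 : (n : ℕ) (V : Set) → V ↔ Fin (suc n) →
    (G : SimpleGraph V) → Connected G → (s : Orientation G) →
    ∃[ D ] IsSpanningRepresentation {n = n} s D
theorem3p3 n V V↔Fin G _ s = differences s φ , record
  { zero⇔cycle = λ p → mk⇔
      -- Equal potentials force equal numbers, and the numbering `to` is injective.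
      (λ p≈0 → inverseʳ⇒injective to inverseʳ
        (potential-injective 0≉1 _ _ (zero⇒equal-potentials s φ p p≈0)))
      (λ { refl → cycle⇒zero s φ p })
  ; tree-spans = λ {T} tree → let open IsSpanningTree tree in
      connected-subgraph-spans s φ {T} subgraph connected
        -- The root is the vertex numbered `zero`, with the zero potential. The shift by one in
        -- `potential` gives the vertex numbered `suc i` the potential `δ i`.
        (from zero) (λ k → cong (λ a → potential a k) (strictlyInverseˡ zero))
        (from ∘ suc) (λ i k → cong (λ a → potential a k) (strictlyInverseˡ (suc i)))
  }
  where
  open Inverse V↔Fin

  φ : V → ℝ^ n
  φ v = potential (to v)
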